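{- Let $A\subseteq\omega$ be an infinite c.e. set and, for every $n\ge1$, let $\theta^{(n)}$ be a quasi-Gödel numbering of $\mathcal S^{(n)}_A$. Then for all $m,n\ge1$ there is a function $\mathrm{sub}\in\mathcal R^{(m+1)}$ such that for all $j,j_1,\dots,j_m\in\omega$, $$\theta^{(n)}_{\mathrm{sub}(j,j_1,\dots,j_m)}=\mathrm{MSubst}^{(m,n)}_A\big(\theta^{(m)}_j;\theta^{(n)}_{j_1},\dots,\theta^{(n)}_{j_m}\big).$$
   Context: $\omega$ is the set of natural numbers; $\mathcal R^{(n)}$ is the set of total computable functions $\omega^n\to\omega$. $\langle\cdot,\cdot\rangle:\omega^2\to\omega$ is a computable bijection with $\langle x,y\rangle\ge x,y$, extended by $\langle x\rangle=x$, $\langle x_1,\dots,x_{n+1}\rangle=\langle x_1,\langle x_2,\dots,x_{n+1}\rangle\rangle$. $\mathrm{Anf}^{(n)}_A$ is the set of partial functions from $\omega^n$ to $\omega$ whose domain is either empty or equal to $\{0,\dots,a-1\}^n$ for some $a\in A$, and $\mathcal S^{(n)}_A=\mathcal R^{(n)}\cup\mathrm{Anf}^{(n)}_A$. The extended graph of an $n$-ary partial function $q$ is $\{\langle\langle\vec y\rangle,0\rangle:\vec y\in\omega^n\}\cup\{\langle\langle\vec x\rangle,q(\vec x)+1\rangle:\vec x\in\mathrm{dom}(q)\}$. A numbering of a set $X$ is a surjection $\omega\to X$. A numbering $\theta$ of $\mathcal S^{(n)}_A$ is a quasi-Gödel numbering if: (QGN I) the extended graph of $(i,\vec x)\mapsto\theta_i(\vec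 x)$ is the range of a function in $\mathcal R^{(1)}$; and (QGN II) for every $k\in\mathcal R^{(2)}$ there is $v\in\mathcal R^{(1)}$ such that for all $i\in\omega$, $r\in\mathcal S^{(n)}_A$: if $\{k(i,t):t\in\omega\}$ is the extended graph of $r$, then $r=\theta_{v(i)}$. Modified substitution: for an $n$-ary partial function $q$ on $\omega$, $\widehat M^{(n)}_A(q)$ is the restriction of $q$ to the set of those $\vec x\in\omega^n$ for which there is $a\in A$ with $\vec x\in\{0,\dots,a-1\}^n\subseteq\mathrm{dom}(q)$ (undefined elsewhere). $\mathrm{Subst}^{(m,n)}(r;p_1,\dots,p_m)$ is the usual composition $\vec x\mapsto r(p_1(\vec x),\dots,p_m(\vec x))$ of an $m$-ary partial function $r$ with $n$-ary partial functions $p_1,\dots,p_m$ (defined at $\vec x$ iff all $p_\nu(\vec x)$ are defined and $r$ is defined at the resulting tuple). $\mathrm{MSubst}^{(m,n)}_A=\widehat M^{(n)}_A\circ\mathrm{Subst}^{(m,n)}$. -}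

module Defs where

open import Level using (0ℓ)
open import Data.Nat.Base using (ℕ; zero; suc; _≤_; _<_)
open import Data.Nat.Properties using (<-cmp)
open import Data.Fin.Base using (Fin)
open import Data.Product using (Σ; Σ-syntax; ∃; ∃-syntax; _×_; _,_; proj₁; uncurry)
open import Data.Sum.Base using (_⊎_)
open import Data.Vec.Base using (Vec; []; _∷_; lookup)
open import Data.Vec.Relation.Unary.All using (All)
open import Data.Vec.Relation.Binary.Pointwise.Extensional using (ext; Pointwise-≡⇒≡)
open import Function.Base using (_∘_)
open import Function.Bundles using (_⇔_)
open import Function.Definitions using (Bijective)
open import Relation.Binary.Definitions using (tri<; tri≈; tri>)
open import Relation.Binary.PropositionalEquality using (_≡_; refl; sym; trans)
open import Relation.Nullary.Negation using (¬_; contradiction)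
open import Relation.Unary using (Pred; Empty; _⊆_; _≐_)

-- Partial functions ωⁿ → ω, as single-valued relations; `graph q x y` reads
-- "q is defined at x, with value y".  Definedness need not be decidable.

record PFun (n : ℕ) : Set₁ where
  field
    graph      : Vec ℕ n → ℕ → Set
    functional : ∀ {x y z} → graph x y → graph x z → y ≡ z

open PFun public

Dom : ∀ {n} → PFun n → Pred (Vec ℕ n) 0ℓ
Dom q x = ∃[ y ] graph q x y

infix 4 _≈_
_≈_ : ∀ {n} → PFun n → PFun n → Set
p ≈ q = ∀ x y → graph p x y ⇔ graph q x y

total : ∀ {n} → (Vec ℕ n → ℕ) → PFun n
total f .graph x y = f x ≡ y
total f .functional e e′ = trans (sym e) e′

Subst : ∀ {m n} → PFun m → (Fin m → PFun n) → PFun n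
Subst r p .graph x y = ∃[ w ] (∀ ν → graph (p ν) x (lookup w ν)) × graph r w y
Subst r p .functional {x} {y} {z} (w , ws , d) (w′ , ws′ , d′)
  with refl ← Pointwise-≡⇒≡ {xs = w} {ys = w′} (ext (λ ν → functional (p ν) (ws ν) (ws′ ν)))
  = functional r d d′

-- Primitive recursion: h(0,x) = p(x), h(k+1,x) = q(k,h(k,x),x).

precGraph : ∀ {n} → PFun n → PFun (suc (suc n)) → Vec ℕ (suc n) → ℕ → Set
precGraph p q (zero  ∷ x) y = graph p x y
precGraph p q (suc k ∷ x) y = ∃[ z ] precGraph p q (k ∷ x) z × graph q (k ∷ z ∷ x) y

Prec : ∀ {n} → PFun n → PFun (suc (suc n)) → PFun (suc n)
Prec p q .graph = precGraph p q
Prec p q .functional {x} = go x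
  where
  go : ∀ x {y z} → precGraph p q x y → precGraph p q x z → y ≡ z
  go (zero  ∷ x) d d′ = functional p d d′
  go (suc k ∷ x) (_ , e , d) (_ , e′ , d′) with refl ← go (k ∷ x) e e′ = functional q d d′

-- Unbounded search: the least y with p(y,x) = 0, provided p(i,x) is defined
-- for all i < y.

Min : ∀ {n} → PFun (suc n) → PFun n
Min p .graph x y = graph p (y ∷ x) 0 × (∀ i → i < y → ∃[ z ] graph p (i ∷ x) (suc z))
Min p .functional {x} {y} {z} (d , b) (d′ , b′) with <-cmp y z
... | tri≈ _ y≡z _ = y≡z
... | tri< y<z _ _ with _ , e ← b′ y y<z = contradiction (functional p d e) λ ()
... | tri> _ _ z<y with _ , e ← b z z<y = contradiction (functional p d′ e) λ ()

-- Computability is given by the μ-recursive functions.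

data Code : ℕ → Set where
  zero : ∀ {n} → Code n
  suc  : Code 1
  proj : ∀ {n} → Fin n → Code n
  comp : ∀ {m n} → Code m → (Fin m → Code n) → Code n
  prec : ∀ {n} → Code n → Code (suc (suc n)) → Code (suc n)
  min  : ∀ {n} → Code (suc n) → Code n

⟦_⟧ : ∀ {n} → Code n → PFun n
⟦ zero ⟧      = total λ _ → 0
⟦ suc ⟧       = total λ { (x ∷ []) → suc x }
⟦ proj i ⟧    = total λ x → lookup x i
⟦ comp c cs ⟧ = Subst ⟦ c ⟧ (λ i → ⟦ cs i ⟧)
⟦ prec c d ⟧  = Prec ⟦ c ⟧ ⟦ d ⟧
⟦ min c ⟧     = Min ⟦ c ⟧

Computable : ∀ {n} → (Vec ℕ n → ℕ) → Set
Computable {n} f = Σ[ c ∈ Code n ] ⟦ c ⟧ ≈ total f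

𝓡 : ℕ → Set
𝓡 n = Σ[ f ∈ (Vec ℕ n → ℕ) ] Computable f

infixl 20 _$_
_$_ : ∀ {n} → 𝓡 n → Vec ℕ n → ℕ
_$_ = proj₁

range : 𝓡 1 → Pred ℕ 0ℓ
range f z = ∃[ t ] f $ (t ∷ []) ≡ z

CE : Pred ℕ 0ℓ → Set
CE A = Empty A ⊎ (∃[ h ] A ≐ range h)

Infinite : Pred ℕ 0ℓ → Set
Infinite A = ∀ b → ∃[ a ] b ≤ a × A a

record Pairing : Set where
  field
    pair       : ℕ → ℕ → ℕ
    computable : Computable {2} λ { (x ∷ y ∷ []) → pair x y }
    bijective  : Bijective _≡_ _≡_ (uncurry pair)
    ≥-left     : ∀ x y → x ≤ pair x y
    ≥-right    : ∀ x y → y ≤ pair x y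

  -- The value at [] is junk: tuples are only meant for arity ≥ 1.
  tuple : ∀ {n} → Vec ℕ n → ℕ
  tuple []           = 0
  tuple (x ∷ [])     = x
  tuple (x ∷ y ∷ ys) = pair x (tuple (y ∷ ys))

  ExtGraph : ∀ {n} → PFun n → Pred ℕ 0ℓ
  ExtGraph {n} q z = (Σ[ y ∈ Vec ℕ n ] z ≡ pair (tuple y) 0)
                   ⊎ (Σ[ x ∈ Vec ℕ n ] ∃[ w ] graph q x w × z ≡ pair (tuple x) (suc w))

-- Cube a x says x ∈ {0,…,a-1}ⁿ.

Cube : ∀ {n} → ℕ → Pred (Vec ℕ n) 0ℓ
Cube a = All (_< a)

TotalComputable : ∀ {n} → PFun n → Set
TotalComputable {n} q = Σ[ f ∈ 𝓡 n ] q ≈ total (f $_)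

Anf : ∀ {n} → Pred ℕ 0ℓ → PFun n → Set
Anf A q = Empty (Dom q) ⊎ (∃[ a ] A a × Dom q ≐ Cube a)

-- The union 𝓡⁽ⁿ⁾ ∪ Anf⁽ⁿ⁾_A is the classical one: membership does not provide a
-- decision as to which part q belongs to.  Under excluded middle the double
-- negation can be dropped.

𝓢 : ∀ {n} → Pred ℕ 0ℓ → PFun n → Set
𝓢 A q = ¬ ¬ (TotalComputable q ⊎ Anf A q)

uncurryPFun : ∀ {n} → (ℕ → PFun n) → PFun (suc n)
uncurryPFun θ .graph (i ∷ x) y = graph (θ i) x y
uncurryPFun θ .functional {i ∷ x} = functional (θ i)

record IsNumberingOf𝓢 {n} (A : Pred ℕ 0ℓ) (θ : ℕ → PFun n) : Set₁ where
  field
    member     : ∀ i → 𝓢 A (θ i)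
    surjective : ∀ r → 𝓢 A r → ∃[ i ] θ i ≈ r

record IsQuasiGödel {n} (π : Pairing) (A : Pred ℕ 0ℓ) (θ : ℕ → PFun n) : Set₁ where
  open Pairing π
  field
    numbering : IsNumberingOf𝓢 A θ
    QGN-I     : ∃[ g ] ExtGraph (uncurryPFun θ) ≐ range g
    QGN-II    : (k : 𝓡 2) → Σ[ v ∈ 𝓡 1 ] ∀ i (r : PFun n) → 𝓢 A r →
                (λ z → ∃[ t ] k $ (i ∷ t ∷ []) ≡ z) ≐ ExtGraph r →
                r ≈ θ (v $ (i ∷ []))

M̂ : ∀ {n} → Pred ℕ 0ℓ → PFun n → PFun n
M̂ A q .graph x y = graph q x y × (∃[ a ] A a × Cube a x × Cube a ⊆ Dom q)
M̂ A q .functional (d , _) (d′ , _) = functional q d d′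

MSubst : ∀ {m n} → Pred ℕ 0ℓ → PFun m → (Fin m → PFun n) → PFun n
MSubst A r p = M̂ A (Subst r p)

module Submission where

-- Uniformly in the indices, the extended graph of the modified composition is
-- semidecidable: the test "{0,…,a-1}ⁿ is contained in the domain" only needs
-- bounded quantification over a semidecidable relation.  So there is a
-- computable enumeration of these extended graphs, and (QGN II) turns it into
-- an index, once the composition q is known to lie in 𝓢.  Up to double
-- negation, members of 𝓢 have decidable domain, hence so has q before M̂ is
-- applied.  If q is total then so is M̂(q), as A is infinite, and it is
-- computable by search; if q is undefined at some point, only finitely many
-- cubes fit into its domain, and the domain of M̂(q) is empty or the largest of
-- these with side in A.

open import Defs
open import Level using (0ℓ)
open import Data.Fin.Base using (Fin; zero; suc)
open import Data.Fin.Properties as Fin using (sequence)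
open import Data.Nat.Base using (ℕ; zero; suc; pred; _+_; _*_; _∸_; _⊔_; _≤_; _<_; z≤n; s≤s; z<s; s<s)
open import Data.Nat.Properties
open import Data.Product using (Σ-syntax; ∃-syntax; _×_; _,_; proj₁; proj₂; uncurry)
open import Data.Product.Properties using (,-injective)
open import Data.Sum.Base using (_⊎_; inj₁; inj₂; [_,_])
open import Data.Vec.Base using (Vec; []; _∷_; lookup; head; tail; take; drop; tabulate; replicate)
open import Data.Vec.Properties using (lookup∘tabulate)
open import Data.Vec.Relation.Binary.Pointwise.Extensional using (ext; Pointwise-≡⇒≡)
open import Data.Vec.Relation.Unary.All as All using ([]; _∷_; all?)
open import Data.Vec.Relation.Unary.All.Properties using (lookup⁺; lookup⁻)
open import Effect.Monad using (RawMonad)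
open import Function.Base using (_∘_; id)
open import Function.Bundles using (_⇔_; mk⇔; module Equivalence)
open import Relation.Binary.PropositionalEquality using (_≡_; refl; sym; trans; cong; cong₂; subst)
open import Relation.Nullary using (yes; no; ¬_; contradiction)
open import Relation.Nullary.Decidable using (decidable-stable; map′; ¬¬-excluded-middle)
open import Relation.Nullary.Negation using (¬¬-Monad; ¬¬-map)
open import Relation.Unary using (Pred; Decidable; _⊆_; _≐_)

open Equivalence using (to; from)

private variable
  k l m n : ℕ
  f g : Vec ℕ k → ℕ
  F : Vec ℕ k → Vec ℕ l
  P Q : Pred (Vec ℕ k) 0ℓ

-- Computable functions

-- One inclusion suffices: the graph of a code is functional, so once it contains the graph of a
-- total function it cannot contain more.
computed-by : (c : Code k) → (∀ x → graph ⟦ c ⟧ x (f x)) → Computable f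
computed-by c e = c , λ x y → mk⇔ (functional ⟦ c ⟧ (e x)) λ { refl → e x }

value : (C : Computable f) → ∀ x → graph ⟦ proj₁ C ⟧ x (f x)
value (_ , e) x = e x _ .from refl

computable-cong : (∀ x → f x ≡ g x) → Computable f → Computable g
computable-cong f≗g C = computed-by (proj₁ C) λ x → subst (graph ⟦ proj₁ C ⟧ x) (f≗g x) (value C x)

-- A record rather than a bare product of components, so that `F` can be read off from the type by
-- unification.
record ComputableVec (F : Vec ℕ k → Vec ℕ l) : Set where
  field component : ∀ i → Computable (λ x → lookup (F x) i)

open ComputableVec

computable-∘ : Computable f → ComputableVec F → Computable (f ∘ F)
computable-∘ {F = F} C Cs = computed-by (comp (proj₁ C) (proj₁ ∘ component Cs))
  λ x → F x , (λ i → value (component Cs i) x) , value C (F x)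

id-computable : ComputableVec {k} id
id-computable .component i = computed-by (proj i) λ _ → refl

[]-computable : ComputableVec {k} (λ _ → [])
[]-computable .component ()

∷-computable : Computable f → ComputableVec F → ComputableVec (λ x → f x ∷ F x)
∷-computable C Cs .component zero    = C
∷-computable C Cs .component (suc i) = component Cs i

computableVec-∘ : {G : Vec ℕ k → Vec ℕ l} → ComputableVec G → ComputableVec F → ComputableVec (G ∘ F)
computableVec-∘ Ds Cs .component i = computable-∘ (component Ds i) Cs

tail-computable : ComputableVec F → ComputableVec (tail ∘ F)
tail-computable {F = F} Cs .component i = computable-cong (λ x → lookup-tail (F x)) (component Cs (suc i))
  where
  lookup-tail : (v : Vec ℕ (suc l)) → ∀ {i} → lookup v (suc i) ≡ lookup (tail v) i
  lookup-tail (_ ∷ _) = refl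

head-computable : ComputableVec F → Computable (head ∘ F)
head-computable {F = F} Cs = computable-cong (λ x → lookup-head (F x)) (component Cs zero)
  where
  lookup-head : (v : Vec ℕ (suc l)) → lookup v zero ≡ head v
  lookup-head (_ ∷ _) = refl

take-computable : ∀ n {F : Vec ℕ k → Vec ℕ (n + l)} → ComputableVec F → ComputableVec (take n ∘ F)
take-computable zero    Cs .component ()
take-computable (suc n) {F} Cs .component i = computable-cong (λ x → eq (F x))
  (component (∷-computable (head-computable Cs) (take-computable n (tail-computable Cs))) i)
  where
  eq : ∀ {i} (v : Vec ℕ (suc n + l)) → lookup (head v ∷ take n (tail v)) i ≡ lookup (take (suc n) v) i
  eq (_ ∷ _) = refl

drop-computable : ∀ n {F : Vec ℕ k → Vec ℕ (n + l)} → ComputableVec F → ComputableVec (drop n ∘ F)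
drop-computable zero    Cs = Cs
drop-computable (suc n) {F} Cs .component i = computable-cong (λ x → eq (F x))
  (component (drop-computable n (tail-computable Cs)) i)
  where
  eq : ∀ {i} (v : Vec ℕ (suc n + l)) → lookup (drop n (tail v)) i ≡ lookup (drop (suc n) v) i
  eq (_ ∷ _) = refl

suc-computable : Computable f → Computable (suc ∘ f)
suc-computable {f = f} C = computed-by (comp suc (λ _ → proj₁ C))
  λ x → f x ∷ [] , (λ { zero → value C x }) , refl

const-computable : ∀ c → Computable {k} (λ _ → c)
const-computable zero    = computed-by zero λ _ → refl
const-computable (suc c) = suc-computable (const-computable c)

constVec-computable : ∀ (v : Vec ℕ l) → ComputableVec {k} (λ _ → v)
constVec-computable v .component i = const-computable (lookup v i)

primrec : (Vec ℕ k → ℕ) → (Vec ℕ (suc (suc k)) → ℕ) → Vec ℕ (suc k) → ℕ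
primrec f g (zero  ∷ x) = f x
primrec f g (suc n ∷ x) = g (n ∷ primrec f g (n ∷ x) ∷ x)

primrec-computable : Computable f → Computable g → Computable (primrec f g)
primrec-computable {f = f} {g = g} C D = computed-by (prec (proj₁ C) (proj₁ D)) go
  where
  go : ∀ v → precGraph ⟦ proj₁ C ⟧ ⟦ proj₁ D ⟧ v (primrec f g v)
  go (zero  ∷ x) = value C x
  go (suc n ∷ x) = primrec f g (n ∷ x) , go (n ∷ x) , value D _

primrec-at-computable : {c : Vec ℕ k → ℕ} → Computable f → Computable g → Computable c → ComputableVec F →
                        Computable (λ x → primrec f g (c x ∷ F x))
primrec-at-computable C D E Fs = computable-∘ (primrec-computable C D) (∷-computable E Fs)

+-computable : Computable f → Computable g → Computable (λ x → f x + g x)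
+-computable {f = f} {g = g} C D = computable-cong (λ x → eq (f x) (g x)) (primrec-at-computable
  (head-computable id-computable)
  (suc-computable (head-computable (tail-computable id-computable)))
  C (∷-computable D []-computable))
  where
  eq : ∀ a b → primrec {1} head (suc ∘ head ∘ tail) (a ∷ b ∷ []) ≡ a + b
  eq zero    b = refl
  eq (suc a) b = cong suc (eq a b)

*-computable : Computable f → Computable g → Computable (λ x → f x * g x)
*-computable {f = f} {g = g} C D = computable-cong (λ x → eq (f x) (g x)) (primrec-at-computable
  (const-computable 0)
  (+-computable (head-computable (tail-computable (tail-computable id-computable)))
    (head-computable (tail-computable id-computable)))
  C (∷-computable D []-computable))
  where
  eq : ∀ a b → primrec {1} (λ _ → 0) (λ v → head (tail (tail v)) + head (tail v)) (a ∷ b ∷ []) ≡ a * b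
  eq zero    b = refl
  eq (suc a) b = cong (b +_) (eq a b)

pred-computable : Computable f → Computable (pred ∘ f)
pred-computable {f = f} C = computable-cong (λ x → eq (f x)) (primrec-at-computable
  (const-computable 0) (head-computable id-computable) C []-computable)
  where
  eq : ∀ a → primrec {0} (λ _ → 0) head (a ∷ []) ≡ pred a
  eq zero    = refl
  eq (suc a) = refl

∸-computable : Computable f → Computable g → Computable (λ x → f x ∸ g x)
∸-computable {f = f} {g = g} C D = computable-cong (λ x → eq (g x) (f x)) (primrec-at-computable
  (head-computable id-computable)
  (pred-computable (head-computable (tail-computable id-computable)))
  D (∷-computable C []-computable))
  where
  eq : ∀ b a → primrec {1} head (pred ∘ head ∘ tail) (b ∷ a ∷ []) ≡ a ∸ b
  eq zero    a = refl
  eq (suc b) a = trans (cong pred (eq b a)) (pred[m∸n]≡m∸[1+n] a b)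

-- Semidecidable predicates

-- `Min` requires all values before the zero it returns to be successors. A known zero bounds the
-- search, which shifts `p` by one at each step.
least-zero : ∀ (p : ℕ → ℕ) n → p n ≡ 0 → ∃[ m ] p m ≡ 0 × (∀ i → i < m → ∃[ z ] p i ≡ suc z)
least-zero p zero    e = 0 , e , λ _ ()
least-zero p (suc n) e with p 0 in e₀
... | zero  = 0 , e₀ , λ _ ()
... | suc z with m , eₘ , below ← least-zero (p ∘ suc) n e =
  suc m , eₘ , λ { zero _ → z , e₀ ; (suc i) (s<s i<m) → below i i<m }

search : Computable f → (∀ x → ∃[ s ] f (s ∷ x) ≡ 0) →
         Σ[ g ∈ (Vec ℕ k → ℕ) ] Computable g × (∀ x → f (g x ∷ x) ≡ 0)
search {f = f} C zeros = proj₁ ∘ least , computed-by (min (proj₁ C)) found , proj₁ ∘ proj₂ ∘ least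
  where
  least : ∀ x → _
  least x = least-zero (λ s → f (s ∷ x)) (proj₁ (zeros x)) (proj₂ (zeros x))

  graph-of : ∀ {x y} → f x ≡ y → graph ⟦ proj₁ C ⟧ x y
  graph-of = proj₂ C _ _ .from

  found : ∀ x → graph ⟦ min (proj₁ C) ⟧ x (proj₁ (least x))
  found x with _ , e , below ← least x =
    graph-of e , λ i i<m → proj₁ (below i i<m) , graph-of (proj₂ (below i i<m))

-- With zero standing for truth, a product is a bounded existential quantifier and a sum a bounded
-- universal one. In the recursion step, `v` lists the counter, the accumulated value and the
-- parameters.
∏< ∑< : (Vec ℕ (suc k) → ℕ) → Vec ℕ (suc k) → ℕ
∏< f = primrec (λ _ → 1) (λ v → f (head v ∷ tail (tail v)) * head (tail v))
∑< f = primrec (λ _ → 0) (λ v → f (head v ∷ tail (tail v)) + head (tail v))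

summand-computable : Computable f → Computable (λ v → f (head v ∷ tail (tail v)))
summand-computable C = computable-∘ C
  (∷-computable (head-computable id-computable) (tail-computable (tail-computable id-computable)))

∏<-computable : Computable f → Computable (∏< f)
∏<-computable C = primrec-computable (const-computable 1)
  (*-computable (summand-computable C) (head-computable (tail-computable id-computable)))

∑<-computable : Computable f → Computable (∑< f)
∑<-computable C = primrec-computable (const-computable 0)
  (+-computable (summand-computable C) (head-computable (tail-computable id-computable)))

∏<≡0 : ∀ (f : Vec ℕ (suc k) → ℕ) b x → ∏< f (b ∷ x) ≡ 0 ⇔ (∃[ y ] y < b × f (y ∷ x) ≡ 0)
∏<≡0 f b x = mk⇔ (⇒ b) (λ { (_ , y<b , e) → ⇐ b y<b e })
  where
  ⇒ : ∀ b → ∏< f (b ∷ x) ≡ 0 → ∃[ y ] y < b × f (y ∷ x) ≡ 0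
  ⇒ (suc b) e with m*n≡0⇒m≡0∨n≡0 (f (b ∷ x)) e
  ... | inj₁ e′ = b , n<1+n b , e′
  ... | inj₂ e′ with y , y<b , e″ ← ⇒ b e′ = y , m<n⇒m<1+n y<b , e″

  ⇐ : ∀ b {y} → y < b → f (y ∷ x) ≡ 0 → ∏< f (b ∷ x) ≡ 0
  ⇐ (suc b) y<1+b e with m<1+n⇒m<n∨m≡n y<1+b
  ... | inj₁ y<b  rewrite ⇐ b y<b e = *-zeroʳ (f (b ∷ x))
  ... | inj₂ refl rewrite e = refl

∑<≡0 : ∀ (f : Vec ℕ (suc k) → ℕ) b x → ∑< f (b ∷ x) ≡ 0 ⇔ (∀ y → y < b → f (y ∷ x) ≡ 0)
∑<≡0 f b x = mk⇔ (⇒ b) (⇐ b)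
  where
  ⇒ : ∀ b → ∑< f (b ∷ x) ≡ 0 → ∀ y → y < b → f (y ∷ x) ≡ 0
  ⇒ (suc b) e y y<1+b with m<1+n⇒m<n∨m≡n y<1+b
  ... | inj₁ y<b  = ⇒ b (m+n≡0⇒n≡0 (f (b ∷ x)) e) y y<b
  ... | inj₂ refl = m+n≡0⇒m≡0 (f (b ∷ x)) e

  ⇐ : ∀ b → (∀ y → y < b → f (y ∷ x) ≡ 0) → ∑< f (b ∷ x) ≡ 0
  ⇐ zero    _ = refl
  ⇐ (suc b) h = cong₂ _+_ (h b (n<1+n b)) (⇐ b λ y → h y ∘ m<n⇒m<1+n)

-- The projection form of a c.e. predicate. Unlike an enumeration by a total function, it covers the
-- empty predicate too.
record Semidecidable (P : Pred (Vec ℕ k) 0ℓ) : Set where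
  field
    test            : Vec ℕ (suc k) → ℕ
    test-computable : Computable test
    test-correct    : ∀ x → P x ⇔ (∃[ t ] test (t ∷ x) ≡ 0)

open Semidecidable

semidecidable-cong : (∀ x → P x ⇔ Q x) → Semidecidable P → Semidecidable Q
semidecidable-cong P⇔Q S .test            = test S
semidecidable-cong P⇔Q S .test-computable = test-computable S
semidecidable-cong P⇔Q S .test-correct x  =
  mk⇔ (to (test-correct S x) ∘ from (P⇔Q x)) (to (P⇔Q x) ∘ from (test-correct S x))

semidecidable-∘ : Semidecidable P → ComputableVec F → Semidecidable (P ∘ F)
semidecidable-∘ {F = F} S Cs .test v            = test S (head v ∷ F (tail v))
semidecidable-∘ {F = F} S Cs .test-computable   = computable-∘ (test-computable S)
  (∷-computable (head-computable id-computable) (computableVec-∘ Cs (tail-computable id-computable)))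
semidecidable-∘ {F = F} S Cs .test-correct x    = test-correct S (F x)

≤-semidecidable : Computable f → Computable g → Semidecidable (λ x → f x ≤ g x)
≤-semidecidable {f = f} {g = g} C D .test v          = f (tail v) ∸ g (tail v)
≤-semidecidable {f = f} {g = g} C D .test-computable =
  ∸-computable (computable-∘ C (tail-computable id-computable)) (computable-∘ D (tail-computable id-computable))
≤-semidecidable C D .test-correct x = mk⇔ (λ f≤g → 0 , m≤n⇒m∸n≡0 f≤g) (m∸n≡0⇒m≤n ∘ proj₂)

-- at-stage f (y ∷ s ∷ x) vanishes iff f (t ∷ y ∷ x) does for some t < s.
at-stage : (Vec ℕ (suc (suc k)) → ℕ) → Vec ℕ (suc (suc k)) → ℕ
at-stage f v = ∏< f (head (tail v) ∷ head v ∷ tail (tail v))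

at-stage-computable : Computable f → Computable (at-stage f)
at-stage-computable C = computable-∘ (∏<-computable C)
  (∷-computable (head-computable (tail-computable id-computable))
    (∷-computable (head-computable id-computable) (tail-computable (tail-computable id-computable))))

-- One stage bounds both the element and its test parameter, so two unbounded searches merge into
-- one without coding pairs. The head of `v` is duplicated because it serves as both bounds.
∃<-at-stage : (Vec ℕ (suc (suc k)) → ℕ) → Vec ℕ (suc k) → ℕ
∃<-at-stage f v = ∏< (at-stage f) (head v ∷ v)

∃<-at-stage-computable : Computable f → Computable (∃<-at-stage f)
∃<-at-stage-computable C =
  computable-∘ (∏<-computable (at-stage-computable C)) (∷-computable (head-computable id-computable) id-computable)

∃<-at-stage≡0 : ∀ (f : Vec ℕ (suc (suc k)) → ℕ) s x →
  ∃<-at-stage f (s ∷ x) ≡ 0 ⇔ (∃[ y ] y < s × ∃[ t ] t < s × f (t ∷ y ∷ x) ≡ 0)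
∃<-at-stage≡0 f s x = mk⇔
  (λ e → let y , y<s , e′ = to (∏<≡0 (at-stage f) s (s ∷ x)) e in y , y<s , to (∏<≡0 f s (y ∷ x)) e′)
  (λ { (y , y<s , e) → from (∏<≡0 (at-stage f) s (s ∷ x)) (y , y<s , from (∏<≡0 f s (y ∷ x)) e) })

∃<-at-stage-zero : ∀ (f : Vec ℕ (suc (suc k)) → ℕ) {t y x} → f (t ∷ y ∷ x) ≡ 0 →
  ∃[ s ] ∃<-at-stage f (s ∷ x) ≡ 0
∃<-at-stage-zero f {t} {y} e = suc (y ⊔ t) ,
  from (∃<-at-stage≡0 f _ _) (y , s≤s (m≤m⊔n y t) , t , s≤s (m≤n⊔m y t) , e)

∃-semidecidable : {R : ℕ → Pred (Vec ℕ k) 0ℓ} →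
                  Semidecidable (λ v → R (head v) (tail v)) → Semidecidable (λ x → ∃[ y ] R y x)
∃-semidecidable S .test            = ∃<-at-stage (test S)
∃-semidecidable S .test-computable = ∃<-at-stage-computable (test-computable S)
∃-semidecidable S .test-correct x  = mk⇔
  (λ { (y , r) → ∃<-at-stage-zero (test S) (proj₂ (to (test-correct S (y ∷ x)) r)) })
  (λ { (s , e) → let y , _ , t , _ , e′ = to (∃<-at-stage≡0 (test S) s x) e
                 in y , from (test-correct S (y ∷ x)) (t , e′) })

-- The conjuncts have independent witnesses: `t` is the test parameter of `both`, while `s` is
-- absorbed by `∃-semidecidable`. A sum vanishes exactly when both summands do.
×-semidecidable : Semidecidable P → Semidecidable Q → Semidecidable (λ x → P x × Q x)
×-semidecidable {P = P} {Q = Q} S T = semidecidable-cong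
  (λ x → mk⇔
    (λ { (s , t , e) → from (test-correct S x) (s , m+n≡0⇒m≡0 (test S (s ∷ x)) e)
                     , from (test-correct T x) (t , m+n≡0⇒n≡0 (test S (s ∷ x)) e) })
    (λ { (p , q) → let s , e = to (test-correct S x) p ; t , e′ = to (test-correct T x) q
                   in s , t , cong₂ _+_ e e′ }))
  (∃-semidecidable {R = λ s x → ∃[ t ] test S (s ∷ x) + test T (t ∷ x) ≡ 0} both)
  where
  both : Semidecidable (λ v → ∃[ t ] test S (head v ∷ tail v) + test T (t ∷ tail v) ≡ 0)
  both .test v          = test S (head (tail v) ∷ tail (tail v)) + test T (head v ∷ tail (tail v))
  both .test-computable = +-computable
    (computable-∘ (test-computable S)
      (∷-computable (head-computable (tail-computable id-computable)) (tail-computable (tail-computable id-computable))))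
    (computable-∘ (test-computable T)
      (∷-computable (head-computable id-computable) (tail-computable (tail-computable id-computable))))
  both .test-correct x  = mk⇔ id id

⊎-semidecidable : Semidecidable P → Semidecidable Q → Semidecidable (λ x → P x ⊎ Q x)
⊎-semidecidable S T .test v          = test S v * test T v
⊎-semidecidable S T .test-computable = *-computable (test-computable S) (test-computable T)
⊎-semidecidable S T .test-correct x  = mk⇔
  [ (λ p → let t , e = to (test-correct S x) p in t , cong (_* test T (t ∷ x)) e)
  , (λ q → let t , e = to (test-correct T x) q
           in t , trans (cong (test S (t ∷ x) *_) e) (*-zeroʳ (test S (t ∷ x)))) ]
  λ { (t , e) → [ (λ e → inj₁ (from (test-correct S x) (t , e))) , (λ e → inj₂ (from (test-correct T x) (t , e))) ]
                (m*n≡0⇒m≡0∨n≡0 (test S (t ∷ x)) e) }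

≡-semidecidable : Computable f → Computable g → Semidecidable (λ x → f x ≡ g x)
≡-semidecidable C D = semidecidable-cong
  (λ x → mk⇔ (uncurry ≤-antisym) λ e → ≤-reflexive e , ≤-reflexive (sym e))
  (×-semidecidable (≤-semidecidable C D) (≤-semidecidable D C))

-- The collection principle: finitely many witnesses have a common bound. It lets a bounded
-- universal quantifier pass inside the search for a stage.
common-bound : {R : ℕ → ℕ → Set} → ∀ b → (∀ y → y < b → ∃[ t ] R t y) →
               ∃[ s ] ∀ y → y < b → ∃[ t ] t < s × R t y
common-bound zero    _ = 0 , λ _ ()
common-bound {R} (suc b) h
  with s , below ← common-bound {R} b (λ y → h y ∘ m<n⇒m<1+n)
  with t , r ← h b (n<1+n b) = suc (s ⊔ t) , bounded
  where
  bounded : ∀ y → y < suc b → ∃[ u ] u < suc (s ⊔ t) × R u y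
  bounded y y<1+b with m<1+n⇒m<n∨m≡n y<1+b
  ... | inj₂ refl = t , s≤s (m≤n⊔m s t) , r
  ... | inj₁ y<b with u , u<s , r′ ← below y y<b = u , m<n⇒m<1+n (m<n⇒m<n⊔o t u<s) , r′

∀<-semidecidable : {R : ℕ → Pred (Vec ℕ k) 0ℓ} → Computable f →
                   Semidecidable (λ v → R (head v) (tail v)) → Semidecidable (λ x → ∀ y → y < f x → R y x)
∀<-semidecidable {f = f} C S .test v          = ∑< (at-stage (test S)) (f (tail v) ∷ v)
∀<-semidecidable {f = f} C S .test-computable = computable-∘ (∑<-computable (at-stage-computable (test-computable S)))
  (∷-computable (computable-∘ C (tail-computable id-computable)) id-computable)
∀<-semidecidable {f = f} {R = R} C S .test-correct x = mk⇔
  (λ h → let s , below = common-bound (f x) (λ y y<b → to (test-correct S (y ∷ x)) (h y y<b))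
         in s , from (∑<≡0 (at-stage (test S)) (f x) (s ∷ x)) λ y y<b → from (∏<≡0 (test S) s _) (below y y<b))
  (λ { (s , e) y y<b → let t , _ , e′ = to (∏<≡0 (test S) s _) (to (∑<≡0 (at-stage (test S)) (f x) (s ∷ x)) e y y<b)
                       in from (test-correct S (y ∷ x)) (t , e′) })

∀Fin-semidecidable : {R : Fin n → Pred (Vec ℕ k) 0ℓ} →
                     (∀ i → Semidecidable (R i)) → Semidecidable (λ x → ∀ i → R i x)
∀Fin-semidecidable {n = zero} S = semidecidable-cong (λ x → mk⇔ (λ _ ()) λ _ → z≤n)
  -- The inequality `0 ≤ 0` serves as the true predicate for the empty conjunction.
  (≤-semidecidable (const-computable 0) (const-computable 0))
∀Fin-semidecidable {n = suc n} S = semidecidable-cong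
  (λ x → mk⇔ (λ { (r , rs) zero → r ; (r , rs) (suc i) → rs i }) λ rs → rs zero , rs ∘ suc)
  (×-semidecidable (S zero) (∀Fin-semidecidable (S ∘ suc)))

∃Vec-semidecidable : ∀ n {R : Vec ℕ n → Pred (Vec ℕ k) 0ℓ} →
                     Semidecidable (λ v → R (take n v) (drop n v)) → Semidecidable (λ x → ∃[ v ] R v x)
∃Vec-semidecidable zero    S = semidecidable-cong (λ x → mk⇔ (λ r → [] , r) λ { ([] , r) → r }) S
∃Vec-semidecidable {k = k} (suc n) {R} S = semidecidable-cong
  (λ x → mk⇔ (λ { (v , y , r) → y ∷ v , r }) λ { (y ∷ v , r) → v , y , r })
  (∃Vec-semidecidable n (∃-semidecidable {R = λ y z → R (y ∷ take n z) (drop n z)}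
    -- The two predicates agree by computation, but only after the vector is split into head and
    -- tail.
    (semidecidable-cong {P = λ v → R (take (suc n) v) (drop (suc n) v)} (λ { (y ∷ z) → mk⇔ id id }) S)))

Cube-∀-semidecidable : ∀ n {R : Vec ℕ n → Pred (Vec ℕ k) 0ℓ} → Computable f →
                       Semidecidable (λ v → R (take n v) (drop n v)) →
                       Semidecidable (λ x → ∀ v → Cube (f x) v → R v x)
Cube-∀-semidecidable zero C S = semidecidable-cong (λ x → mk⇔ (λ { r [] [] → r }) λ r → r [] []) S
Cube-∀-semidecidable {f = f} (suc n) {R} C S = semidecidable-cong
  (λ x → mk⇔ (λ { r (y ∷ v) (y<b ∷ v<b) → r v v<b y y<b }) λ r v v<b y y<b → r (y ∷ v) (y<b ∷ v<b))
  (Cube-∀-semidecidable n C (∀<-semidecidable {R = λ y z → R (y ∷ take n z) (drop n z)}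
    (computable-∘ C (drop-computable n id-computable))
    (semidecidable-cong {P = λ v → R (take (suc n) v) (drop (suc n) v)} (λ { (y ∷ z) → mk⇔ id id }) S)))

-- Two searches in succession: the first finds a stage below which some `y` has a witness. With that
-- stage fixed, being such a `y` is decidable, and the second search finds one.
uniformization : Semidecidable P → (∀ x → ∃[ y ] P (y ∷ x)) →
                 Σ[ f ∈ (Vec ℕ k → ℕ) ] Computable f × (∀ x → P (f x ∷ x))
uniformization {k = k} {P = P} S total = select (search (∃<-at-stage-computable (test-computable S))
  λ x → ∃<-at-stage-zero (test S) (proj₂ (to (test-correct S _) (proj₂ (total x)))))
  where
  select : Σ[ stage ∈ (Vec ℕ k → ℕ) ] Computable stage × (∀ x → ∃<-at-stage (test S) (stage x ∷ x) ≡ 0) →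
           Σ[ f ∈ (Vec ℕ k → ℕ) ] Computable f × (∀ x → P (f x ∷ x))
  select (stage , stage-computable , at) = conclude (search
    {f = λ v → ∏< (test S) (stage (tail v) ∷ v)}
    (computable-∘ (∏<-computable (test-computable S))
      (∷-computable (computable-∘ stage-computable (tail-computable id-computable)) id-computable))
    λ x → let y , _ , e = to (∃<-at-stage≡0 (test S) (stage x) x) (at x)
          in y , from (∏<≡0 (test S) (stage x) (y ∷ x)) e)
    where
    conclude : Σ[ f ∈ (Vec ℕ k → ℕ) ] Computable f × (∀ x → ∏< (test S) (stage x ∷ f x ∷ x) ≡ 0) →
               Σ[ f ∈ (Vec ℕ k → ℕ) ] Computable f × (∀ x → P (f x ∷ x))
    conclude (f , f-computable , zeros) = f , f-computable , λ x →
      let t , _ , e = to (∏<≡0 (test S) (stage x) (f x ∷ x)) (zeros x)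
      in from (test-correct S (f x ∷ x)) (t , e)

-- Tuples and uniformly semidecidable families of partial functions

module Tuples (π : Pairing) where
  open Pairing π

  pair-injective : ∀ {a b c d} → pair a b ≡ pair c d → a ≡ c × b ≡ d
  pair-injective e = ,-injective (proj₁ bijective e)

  pair-surjective : ∀ z → ∃[ x ] ∃[ y ] pair x y ≡ z
  pair-surjective z with (x , y) , e ← proj₂ bijective z = x , y , e refl

  pair-computable : Computable f → Computable g → Computable (λ x → pair (f x) (g x))
  pair-computable C D = computable-∘ computable (∷-computable C (∷-computable D []-computable))

  tuple-computable : ∀ n → Computable (tuple {suc n})
  tuple-computable zero    = computable-cong (λ { (x ∷ []) → refl }) (head-computable id-computable)
  tuple-computable (suc n) = computable-cong (λ { (x ∷ y ∷ ys) → refl })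
    (pair-computable (head-computable id-computable) (computable-∘ (tuple-computable n) (tail-computable id-computable)))

  tuple-injective : (x y : Vec ℕ (suc n)) → tuple x ≡ tuple y → x ≡ y
  tuple-injective (x ∷ [])     (y ∷ [])     refl = refl
  tuple-injective (x ∷ u ∷ us) (y ∷ v ∷ vs) e with refl , e′ ← pair-injective e =
    cong (x ∷_) (tuple-injective (u ∷ us) (v ∷ vs) e′)

  tuple-surjective : ∀ n z → Σ[ x ∈ Vec ℕ (suc n) ] tuple x ≡ z
  tuple-surjective zero    z = z ∷ [] , refl
  tuple-surjective (suc n) z with x , y , refl ← pair-surjective z with v ∷ vs , refl ← tuple-surjective n y =
    x ∷ v ∷ vs , refl

  -- A total function cannot enumerate the empty set; the common element `d` keeps `next` total at
  -- arguments that certify nothing, and uniformization then yields `k`.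
  enumeration : {R : ℕ → ℕ → Set} → Semidecidable {2} (λ v → R (head v) (head (tail v))) →
                ∀ d → (∀ i → R i d) → Σ[ k ∈ 𝓡 2 ] ∀ i z → (∃[ t ] k $ (i ∷ t ∷ []) ≡ z) ⇔ R i z
  enumeration {R} S d Rd = conclude (uniformization next-semidecidable next-total)
    where
    -- At t = ⟨z , s⟩ the value z is forced once s witnesses R i z; otherwise
    -- any element of R i will do.
    next : Pred (Vec ℕ 3) 0ℓ
    next v = R (head (tail v)) (head v) × (∃[ z ] ∃[ s ] head (tail (tail v)) ≡ pair z s ×
               (1 ≤ test S (s ∷ head (tail v) ∷ z ∷ []) ⊎ head v ≡ z))

    next-semidecidable : Semidecidable next
    next-semidecidable = ×-semidecidable
      (semidecidable-∘ S (∷-computable i (∷-computable y []-computable)))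
      (∃-semidecidable (∃-semidecidable (×-semidecidable
        (≡-semidecidable (head-computable (tail-computable (tail-computable v))) (pair-computable z s))
        (⊎-semidecidable
          -- Failure of the test is written positively as `1 ≤ test`, which keeps `next`
          -- semidecidable.
          (≤-semidecidable (const-computable 1)
            (computable-∘ (test-computable S)
              (∷-computable s (∷-computable (head-computable (tail-computable v)) (∷-computable z []-computable)))))
          (≡-semidecidable (head-computable v) z)))))
      where
      y = head-computable id-computable
      i = head-computable (tail-computable id-computable)
      s = head-computable id-computable
      z = head-computable (tail-computable id-computable)
      v = tail-computable (tail-computable id-computable)

    next-total : ∀ x → ∃[ y ] next (y ∷ x)
    next-total (i ∷ t ∷ []) with z , s , refl ← pair-surjective t with test S (s ∷ i ∷ z ∷ []) in e
    ... | zero  = z , from (test-correct S (i ∷ z ∷ [])) (s , e) , z , s , refl , inj₂ refl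
    ... | suc _ = d , Rd i , z , s , refl , inj₁ (subst (1 ≤_) (sym e) z<s)

    forced : ∀ {i z s y} → test S (s ∷ i ∷ z ∷ []) ≡ 0 →
             (∃[ z′ ] ∃[ s′ ] pair z s ≡ pair z′ s′ × (1 ≤ test S (s′ ∷ i ∷ z′ ∷ []) ⊎ y ≡ z′)) → y ≡ z
    forced e (_ , _ , p , q) with refl , refl ← pair-injective p with q
    ... | inj₁ 1≤ = contradiction (subst (1 ≤_) e 1≤) λ ()
    ... | inj₂ eq = eq

    conclude : Σ[ k ∈ (Vec ℕ 2 → ℕ) ] Computable k × (∀ x → next (k x ∷ x)) →
               Σ[ k ∈ 𝓡 2 ] ∀ i z → (∃[ t ] k $ (i ∷ t ∷ []) ≡ z) ⇔ R i z
    conclude (k , k-computable , next-k) = (k , k-computable) , λ i z → mk⇔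
      (λ { (t , refl) → proj₁ (next-k (i ∷ t ∷ [])) })
      λ r → let s , e = to (test-correct S (i ∷ z ∷ [])) r
            in pair z s , forced e (proj₂ (next-k (i ∷ pair z s ∷ [])))

  -- Quantifying over computable `G`, `F` and `f` builds closure under substitution into the notion,
  -- so parameters, arguments and value need not be packed into one vector.
  record UniformlySemidecidable (p : Vec ℕ k → PFun n) : Set where
    field
      graph-semidecidable : ∀ {l} {G : Vec ℕ l → Vec ℕ k} {F : Vec ℕ l → Vec ℕ n} {f} →
        ComputableVec G → ComputableVec F → Computable f → Semidecidable (λ v → graph (p (G v)) (F v) (f v))

  open UniformlySemidecidable public

  reindex : {p : Vec ℕ k → PFun n} → UniformlySemidecidable p → ComputableVec F → UniformlySemidecidable (p ∘ F)
  reindex U Cs .graph-semidecidable Gs = graph-semidecidable U (computableVec-∘ Cs Gs)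

  Dom-semidecidable : {p : Vec ℕ k → PFun n} {G : Vec ℕ l → Vec ℕ k} {F : Vec ℕ l → Vec ℕ n} →
    UniformlySemidecidable p → ComputableVec G → ComputableVec F → Semidecidable (λ v → Dom (p (G v)) (F v))
  Dom-semidecidable U Gs Fs = ∃-semidecidable (graph-semidecidable U
    (computableVec-∘ Gs (tail-computable id-computable))
    (computableVec-∘ Fs (tail-computable id-computable))
    (head-computable id-computable))

  Subst-semidecidable : {r : Vec ℕ k → PFun m} {p : Fin m → Vec ℕ k → PFun n} →
    UniformlySemidecidable r → (∀ ν → UniformlySemidecidable (p ν)) →
    UniformlySemidecidable (λ c → Subst (r c) (λ ν → p ν c))
  Subst-semidecidable {m = m} U V .graph-semidecidable Gs Fs C =
    ∃Vec-semidecidable m (×-semidecidable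
      (∀Fin-semidecidable λ ν → graph-semidecidable (V ν)
        (computableVec-∘ Gs v) (computableVec-∘ Fs v) (component w ν))
      (graph-semidecidable U (computableVec-∘ Gs v) w (computable-∘ C v)))
    where
    w = take-computable m id-computable
    v = drop-computable m id-computable

  M̂-semidecidable : ∀ {A} {p : Vec ℕ k → PFun n} → Semidecidable {1} (A ∘ head) →
    UniformlySemidecidable p → UniformlySemidecidable (M̂ A ∘ p)
  M̂-semidecidable {n = n} {p = p} S U .graph-semidecidable {G = G} Gs Fs C = ×-semidecidable
    (graph-semidecidable U Gs Fs C)
    (∃-semidecidable (×-semidecidable
      (semidecidable-∘ S (∷-computable a []-computable))
      (×-semidecidable
        (semidecidable-cong (λ _ → mk⇔ lookup⁻ lookup⁺)
          (∀Fin-semidecidable λ ν → ≤-semidecidable (suc-computable (component (computableVec-∘ Fs v) ν)) a))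
        -- Inclusion of the cube in the domain is a universal quantifier bounded by `a`, here with
        -- its point made explicit.
        (semidecidable-cong {P = λ x → ∀ v → Cube (head x) v → Dom (p (G (tail x))) v}
          (λ _ → mk⇔ (λ h {v} → h v) λ h v → h {v})
          (Cube-∀-semidecidable n a (Dom-semidecidable U
            (computableVec-∘ (computableVec-∘ Gs v) (drop-computable n id-computable))
            (take-computable n id-computable)))))))
    where
    a = head-computable id-computable
    v = tail-computable id-computable

  ExtGraph-semidecidable : {p : Vec ℕ k → PFun (suc n)} {G : Vec ℕ l → Vec ℕ k} →
    UniformlySemidecidable p → ComputableVec G → Computable f → Semidecidable (λ v → ExtGraph (p (G v)) (f v))
  ExtGraph-semidecidable {n = n} U Gs C = ⊎-semidecidable
    (∃Vec-semidecidable (suc n) (≡-semidecidable (computable-∘ C (drop-computable (suc n) id-computable))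
      (pair-computable (computable-∘ (tuple-computable n) (take-computable (suc n) id-computable)) (const-computable 0))))
    (∃Vec-semidecidable (suc n) (∃-semidecidable (×-semidecidable
      (graph-semidecidable U (computableVec-∘ Gs v) x w)
      (≡-semidecidable (computable-∘ C v)
        (pair-computable (computable-∘ (tuple-computable n) x) (suc-computable w))))))
    where
    x = take-computable (suc n) (tail-computable id-computable)
    v = drop-computable (suc n) (tail-computable id-computable)
    w = head-computable id-computable

  -- The second component separates the padding, marked by 0, from genuine values, marked by a
  -- successor. Injectivity of tupling in positive arity recovers the argument.
  ExtGraph-graph : (q : PFun (suc n)) → ∀ {x y} → ExtGraph q (pair (tuple x) (suc y)) ⇔ graph q x y
  ExtGraph-graph q {x} {y} = mk⇔ ⇒ λ d → inj₂ (x , y , d , refl)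
    where
    ⇒ : ExtGraph q (pair (tuple x) (suc y)) → graph q x y
    ⇒ (inj₁ (_ , e)) = contradiction (proj₂ (pair-injective e)) λ ()
    ⇒ (inj₂ (x′ , _ , d , e)) with e₁ , refl ← pair-injective e with refl ← tuple-injective x x′ e₁ = d

  -- This is how (QGN I) enters: a value of the numbering is confirmed by finding its code in the
  -- range of `g`.
  graph-semidecidable-from-range : {θ : ℕ → PFun n} → (∃[ g ] ExtGraph (uncurryPFun θ) ≐ range g) →
                                   UniformlySemidecidable {1} (θ ∘ head)
  graph-semidecidable-from-range {n = n} {θ} (g , θ≐range-g) .graph-semidecidable {G = G} {F} {f} Gs Fs C =
    semidecidable-cong
      (λ x → mk⇔
        (to (ExtGraph-graph (uncurryPFun θ) {head (G x) ∷ F x}) ∘ proj₂ θ≐range-g)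
        (proj₁ θ≐range-g ∘ from (ExtGraph-graph (uncurryPFun θ) {head (G x) ∷ F x})))
      (∃-semidecidable {R = λ t x → g $ (t ∷ []) ≡ pair (tuple (head (G x) ∷ F x)) (suc (f x))} (≡-semidecidable
        (computable-∘ (proj₂ g) (∷-computable (head-computable id-computable) []-computable))
        (pair-computable
          (computable-∘ (tuple-computable n)
            (∷-computable (head-computable (computableVec-∘ Gs tails)) (computableVec-∘ Fs tails)))
          (suc-computable (computable-∘ C tails)))))
    where
    tails = tail-computable id-computable

-- Membership in 𝓢

-- The domain is everything, nothing or a cube, and each of these is decidable. Which case holds is
-- known only up to double negation, and so is the conclusion.
𝓢⇒¬¬Dom-decidable : ∀ {A} {q : PFun n} → 𝓢 A q → ¬ ¬ (Decidable (Dom q))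
𝓢⇒¬¬Dom-decidable {q = q} = ¬¬-map λ
  { (inj₁ ((f , _) , q≈f)) x → yes (f x , from (q≈f x (f x)) refl)
  ; (inj₂ (inj₁ empty)) x → no (empty x)
  ; (inj₂ (inj₂ (a , _ , ⊆Cube , Cube⊆))) x → map′ Cube⊆ ⊆Cube (all? (_<? a) x)
  }

-- When all inner functions are defined at `x`, functionality leaves a single intermediate tuple
-- `w`, so only the domain of `r` at `w` remains to be decided.
Subst-Dom-decidable : {r : PFun m} {p : Fin m → PFun n} → Decidable (Dom r) → (∀ ν → Decidable (Dom (p ν))) →
                      Decidable (Dom (Subst r p))
Subst-Dom-decidable {r = r} {p} r? p? x with Fin.all? (λ ν → p? ν x)
... | no ¬all = no λ { (_ , w , ws , _) → ¬all λ ν → lookup w ν , ws ν }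
... | yes all = map′ (λ { (y , d) → y , w , ws , d }) only-w (r? w)
  where
  w = tabulate (proj₁ ∘ all)

  ws : ∀ ν → graph (p ν) x (lookup w ν)
  ws ν = subst (graph (p ν) x) (sym (lookup∘tabulate (proj₁ ∘ all) ν)) (proj₂ (all ν))

  only-w : Dom (Subst r p) x → Dom r w
  only-w (y , w′ , ws′ , d)
    with refl ← Pointwise-≡⇒≡ {xs = w} {ys = w′} (ext λ ν → functional (p ν) (ws ν) (ws′ ν)) = y , d

Cube-mono : ∀ {a b} {x : Vec ℕ n} → a ≤ b → Cube a x → Cube b x
Cube-mono a≤b = All.map λ x<a → <-≤-trans x<a a≤b

Cube-cover : (x : Vec ℕ n) → ∃[ a ] Cube a x
Cube-cover []      = 0 , []
Cube-cover (y ∷ x) with a , x<a ← Cube-cover x =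
  suc y ⊔ a , m≤m⊔n (suc y) a ∷ Cube-mono (m≤n⊔m (suc y) a) x<a

-- Downward search for the largest side in `A` whose cube fits into the domain of `q`. Cubes are
-- nested, so the largest is the whole domain of `M̂ A q`; if the bound reaches 0, none fits and the
-- domain is empty. Excluded middle at each side is available because the goal is doubly negated.
M̂-Anf : ∀ {A} (q : PFun n) b → (∀ a → A a → Cube a ⊆ Dom q → a < b) → ¬ ¬ Anf A (M̂ A q)
M̂-Anf q zero    bound ¬anf = ¬anf (inj₁ λ { x (_ , _ , a , a∈A , _ , sub) → contradiction (bound a a∈A sub) λ () })
M̂-Anf {A = A} q (suc b) bound ¬anf = ¬¬-excluded-middle {A = A b × Cube b ⊆ Dom q} λ
  { (yes (b∈A , sub)) → ¬anf (inj₂ (b , b∈A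
      , (λ { (_ , _ , a , a∈A , x<a , sub′) → Cube-mono (m<1+n⇒m≤n (bound a a∈A sub′)) x<a })
      , λ x<b → proj₁ (sub x<b) , proj₂ (sub x<b) , b , b∈A , x<b , sub))
  ; (no ¬b) → M̂-Anf q b (λ a a∈A sub → ≤∧≢⇒< (m<1+n⇒m≤n (bound a a∈A sub)) λ { refl → ¬b (a∈A , sub) }) ¬anf
  }

-- Every point lies in some cube, and an infinite `A` has a side at least as large; totality of `q`
-- makes that larger cube admissible.
M̂-total : ∀ {A} (q : PFun n) → Infinite A → (∀ x → Dom q x) → ∀ x → Dom (M̂ A q) x
M̂-total q infinite q-total x
  with b , x<b ← Cube-cover x with a , b≤a , a∈A ← infinite b =
  proj₁ (q-total x) , proj₂ (q-total x) , a , a∈A , Cube-mono b≤a x<b , λ {x′} _ → q-total x′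

M̂-∈𝓢 : ∀ {A} (q : PFun n) → Infinite A → Decidable (Dom q) →
        ((∀ x → Dom (M̂ A q) x) → TotalComputable (M̂ A q)) → 𝓢 A (M̂ A q)
M̂-∈𝓢 {A = A} q infinite q? computable ¬member = ¬¬-excluded-middle {A = ∃[ x ] ¬ Dom q x} λ
  { (yes (x , x∉)) → let b , x<b = Cube-cover x in
      -- A cube of side at least `b` contains the gap `x`, so it cannot lie inside the domain.
      M̂-Anf q b (λ a _ sub → ≰⇒> λ b≤a → x∉ (sub (Cube-mono b≤a x<b))) (¬member ∘ inj₂)
  ; (no ¬∃) → ¬member (inj₁ (computable (M̂-total {A = A} q infinite
      -- Absence of a gap gives definedness only up to double negation; decidability of the domain
      -- removes it.
      λ x → decidable-stable (q? x) λ x∉ → ¬∃ (x , x∉))))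
  }

-- Uniformization selects some value at each argument, and functionality makes it the value of `q`.
total⇒computable : (q : PFun n) → Semidecidable (λ v → graph q (tail v) (head v)) → (∀ x → Dom q x) → TotalComputable q
total⇒computable {n = n} q S q-total = conclude (uniformization S q-total)
  where
  conclude : Σ[ f ∈ (Vec ℕ n → ℕ) ] Computable f × (∀ x → graph q x (f x)) → TotalComputable q
  conclude (f , f-computable , q-f) = (f , f-computable) , λ x y → mk⇔ (functional q (q-f x)) λ { refl → q-f x }

-- Computing an index of the modified composition

theorem4p7 : (π : Pairing) (A : Pred ℕ 0ℓ) → Infinite A → CE A →
    (θ : (n : ℕ) → ℕ → PFun n) → (∀ n → 1 ≤ n → IsQuasiGödel π A (θ n)) →
    ∀ m n → 1 ≤ m → 1 ≤ n →
    Σ[ sub ∈ 𝓡 (suc m) ] ∀ j (js : Vec ℕ m) →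
    θ n (sub $ (j ∷ js)) ≈ MSubst A (θ m j) (λ ν → θ n (lookup js ν))
theorem4p7 π A infinite (inj₁ empty) = contradiction (proj₂ (proj₂ (infinite 0))) (empty _)
theorem4p7 π A infinite (inj₂ (h , A≐range-h)) θ Q (suc m) (suc n) 1≤m 1≤n =
  index enumerator
  where
  open Pairing π using (pair; tuple; ExtGraph)
  open Tuples π
  open IsQuasiGödel
  open IsNumberingOf𝓢

  composite : Vec ℕ (suc (suc m)) → PFun (suc n)
  composite js = Subst (θ (suc m) (head js)) (λ ν → θ (suc n) (lookup (tail js) ν))

  q : Vec ℕ (suc (suc m)) → PFun (suc n)
  q js = M̂ A (composite js)

  A-semidecidable : Semidecidable {1} (A ∘ head)
  A-semidecidable = semidecidable-cong (λ _ → mk⇔ (proj₂ A≐range-h) (proj₁ A≐range-h))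
    (∃-semidecidable {R = λ t v → h $ (t ∷ []) ≡ head v} (≡-semidecidable
      (computable-∘ (proj₂ h) (∷-computable (head-computable id-computable) []-computable))
      (head-computable (tail-computable id-computable))))

  θ-semidecidable : ∀ n → 1 ≤ n → UniformlySemidecidable {1} (θ n ∘ head)
  θ-semidecidable n 1≤n = graph-semidecidable-from-range (QGN-I (Q n 1≤n))

  q-semidecidable : UniformlySemidecidable q
  q-semidecidable = M̂-semidecidable A-semidecidable (Subst-semidecidable
    (reindex (θ-semidecidable (suc m) 1≤m) (∷-computable (head-computable id-computable) []-computable))
    λ ν → reindex (θ-semidecidable (suc n) 1≤n)
      (∷-computable (component (tail-computable id-computable) ν) []-computable))

  -- (QGN II) accepts a single parameter, so all indices are packed into `i`. Searching for `js`
  -- with the right code replaces computable decoding.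
  R : ℕ → ℕ → Set
  R i z = Σ[ js ∈ Vec ℕ (suc (suc m)) ] tuple js ≡ i × ExtGraph (q js) z

  R-semidecidable : Semidecidable {2} (λ v → R (head v) (head (tail v)))
  R-semidecidable = ∃Vec-semidecidable (suc (suc m)) (×-semidecidable
    (≡-semidecidable (computable-∘ (tuple-computable (suc m)) js) (head-computable iz))
    (ExtGraph-semidecidable q-semidecidable js (head-computable (tail-computable iz))))
    where
    js = take-computable (suc (suc m)) id-computable
    iz = drop-computable (suc (suc m)) id-computable

  origin : Vec ℕ (suc n)
  origin = replicate _ 0

  -- Padding belongs to every extended graph, even that of the empty function, and so supplies the
  -- common element for `enumeration`.
  R-origin : ∀ i → R i (pair (tuple origin) 0)
  R-origin i with js , e ← tuple-surjective (suc m) i = js , e , inj₁ (origin , refl)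

  enumerator : Σ[ k ∈ 𝓡 2 ] ∀ i z → (∃[ t ] k $ (i ∷ t ∷ []) ≡ z) ⇔ R i z
  enumerator = enumeration R-semidecidable (pair (tuple origin) 0) R-origin

  -- Membership in `𝓢` is a negation, so doubly negated decidability of the component domains may be
  -- used as if it were decidability.
  q∈𝓢 : ∀ js → 𝓢 A (q js)
  q∈𝓢 js ¬member =
    𝓢⇒¬¬Dom-decidable {q = outer} (member (numbering (Q (suc m) 1≤m)) (head js)) λ outer? →
    -- Double negation commutes with a quantifier over a finite set.
    sequence (RawMonad.rawApplicative ¬¬-Monad)
      (λ ν → 𝓢⇒¬¬Dom-decidable {q = inner ν} (member (numbering (Q (suc n) 1≤n)) (lookup (tail js) ν))) λ inner? →
    M̂-∈𝓢 (composite js) infinite (Subst-Dom-decidable {r = outer} {inner} outer? inner?)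
      -- Here the indices are fixed, so they enter as constants.
      (total⇒computable (q js) (graph-semidecidable q-semidecidable (constVec-computable js)
        (tail-computable id-computable) (head-computable id-computable))) ¬member
    where
    outer : PFun (suc m)
    outer = θ (suc m) (head js)

    inner : Fin (suc m) → PFun (suc n)
    inner ν = θ (suc n) (lookup (tail js) ν)

  index : Σ[ k ∈ 𝓡 2 ] (∀ i z → (∃[ t ] k $ (i ∷ t ∷ []) ≡ z) ⇔ R i z) →
          Σ[ sub ∈ 𝓡 (suc (suc m)) ] ∀ j js → θ (suc n) (sub $ (j ∷ js)) ≈ q (j ∷ js)
  index (k , k-enumerates) = reindexed (QGN-II (Q (suc n) 1≤n) k)
    where
    k-enumerates-q : ∀ js → (λ z → ∃[ t ] k $ (tuple js ∷ t ∷ []) ≡ z) ≐ ExtGraph (q js)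
    k-enumerates-q js = (λ {z} t → at-js (to (k-enumerates (tuple js) z) t))
      , λ {z} e → from (k-enumerates (tuple js) z) (js , refl , e)
      where
      at-js : ∀ {z} → R (tuple js) z → ExtGraph (q js) z
      -- Injectivity of tupling ensures that a code contributes the extended graph of just one
      -- composition.
      at-js (js′ , e , z∈) with refl ← tuple-injective js′ js e = z∈

    reindexed : Σ[ v ∈ 𝓡 1 ] (∀ i r → 𝓢 A r → (λ z → ∃[ t ] k $ (i ∷ t ∷ []) ≡ z) ≐ ExtGraph r →
                              r ≈ θ (suc n) (v $ (i ∷ []))) →
                Σ[ sub ∈ 𝓡 (suc (suc m)) ] ∀ j js → θ (suc n) (sub $ (j ∷ js)) ≈ q (j ∷ js)
    reindexed (v , v-correct) =
      ((λ js → v $ (tuple js ∷ [])) , computable-∘ (proj₂ v) (∷-computable (tuple-computable (suc m)) []-computable))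
      , λ j js x y → let q≈θ = v-correct (tuple (j ∷ js)) (q (j ∷ js)) (q∈𝓢 (j ∷ js)) (k-enumerates-q (j ∷ js)) x y
                     in mk⇔ (from q≈θ) (to q≈θ)
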